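{- Let $\mathcal T$ be the set of ordered pairs $(a,b)$ of positive integers with $a<b$ for which $9a^2b^2-12(a+b)^2$ is a square. Then $\mathcal T$ equals the set of pairs $(a,b)=2(q,r)=(2q,2r)$, with $q,r\in\mathbb{N}$, for which there exist unique odd, coprime, positive integers $s,t$ such that $$s^2+3t^2+2q^2=6stq\quad\text{and}\quad q\le r=3st-q.$$ Furthermore, if $(a,b)=2(q,r)\in\mathcal T$ and $s,t$ are the corresponding integers, then $ab=2(s^2+3t^2)$ and $a+b=6st$. Moreover, $q$ and $r$ are coprime; in particular, $3\nmid ab$.
   Context: $\mathbb{N}$ denotes the set of strictly positive integers. "Square" means the square of an integer. -}

module Defs where

open import Data.Nat using (ℕ; _+_; _*_; _^_; _≤_; _<_)
open import Data.Nat.Coprimality using (Coprime)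
open import Data.Nat.Divisibility using (_∤_)
import Data.Integer as ℤ
open ℤ using (ℤ; +_)
open import Data.Product using (_×_; _,_; ∃; ∃₂; ∃!)
open import Level using (0ℓ)
open import Relation.Binary.PropositionalEquality using (_≡_)
open import Relation.Unary using (Pred)

Odd : ℕ → Set
Odd n = 2 ∤ n

IsSquare : ℤ → Set
IsSquare z = ∃ λ (k : ℤ) → z ≡ k ℤ.^ 2

-- The difference is taken in ℤ, where it may be negative (for instance
-- when a = 1).
𝒯 : Pred (ℕ × ℕ) 0ℓ
𝒯 (a , b) =
    0 < a × 0 < b × a < b
  × IsSquare (+ (9 * a ^ 2 * b ^ 2) ℤ.- + (12 * (a + b) ^ 2))

-- The subtraction in r = 3st − q is likewise that of ℤ, not truncated.
Corresponds : ℕ → ℕ → Pred (ℕ × ℕ) 0ℓ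
Corresponds q r (s , t) =
    0 < s × 0 < t × Odd s × Odd t × Coprime s t
  × s ^ 2 + 3 * t ^ 2 + 2 * q ^ 2 ≡ 6 * s * t * q
  × q ≤ r × + r ≡ + (3 * s * t) ℤ.- + q

𝒮 : Pred (ℕ × ℕ) 0ℓ
𝒮 (a , b) = ∃₂ λ q r →
    0 < q × 0 < r × (a , b) ≡ (2 * q , 2 * r)
  × ∃! _≡_ (Corresponds q r)

{-# OPTIONS --safe #-}

-- Put k² = 9a²b² − 12(a + b)². Then a + b = 3c, and factoring
-- (ab)² − (k/3)² = 12c² gives uv = 3c² with u + v = ab. Hence c = gst and
-- u + v = gs² + 3gt², so that (a, s, t) solves the Markov-type equation
-- a² + gs² + 3gt² = 3gsta. Let A = a², B = gs², C = 3gt². Replacing a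
-- variable by the other root of the equation decreases it exactly when its
-- term exceeds the sum of the other two terms. If no term does, then
-- (A + B + C)² = 3ABC under the triangle inequalities bounds A, B and C, and
-- only g = 2, (a, s, t) = (2, 1, 1) remains. The replacements preserve g, the
-- parities and the coprimality of s and t, which therefore hold for every
-- solution. Uniqueness holds because s² and 3t² have known sum and product
-- and 3 ∤ s.

module Submission where

open import Defs
open import Algebra.Bundles using (AbelianGroup)
open import Data.Nat using (ℕ; zero; suc; _+_; _*_; _^_; _∸_; ∣_-_∣; _≤_; _<_; z≤n; s≤s; _<?_; NonZero; >-nonZero; ≢-nonZero)
open import Data.Nat.Coprimality using (Coprime; coprime-divisor; coprime-/gcd)
open import Data.Nat.Divisibility using (_∣_; _∤_; _∣?_; divides; ∣-refl; ∣-trans; ∣m∣n⇒∣m+n; ∣m+n∣m⇒∣n; ∣n⇒∣m*n; ∣m⇒∣m*n; m∣m*n; ∣1⇒≡1)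
open import Data.Nat.DivMod using (_/_; m/n*n≡m)
open import Data.Nat.GCD using (gcd; gcd[m,n]∣m; gcd[m,n]∣n; gcd[m,n]≢0)
open import Data.Nat.Properties
open import Data.Nat.Primality using (Prime; prime?; prime[2]; euclidsLemma; prime⇒irreducible)
open import Data.Nat.Tactic.RingSolver using (solve-∀)
open import Data.Product using (_×_; _,_; ∃; ∃₂)
open import Data.Sum using (_⊎_; inj₁; inj₂; [_,_]′)
open import Function using (id; _∘_)
open import Data.Nat.Induction using (Acc; acc; <-wellFounded)
open import Relation.Binary.PropositionalEquality
open import Relation.Nullary using (yes; no; contradiction)
open import Relation.Nullary.Decidable using (from-yes; from-no)
open import Relation.Unary using (_∈_; _≐_)
import Algebra.Properties.Group as GroupProperties
import Data.Integer as ℤ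
import Data.Integer.Properties as ℤₚ

-- Elementary facts and Vieta jumping.

m≢m+1+n : ∀ m {k n} → k ≡ m → k ≡ m + suc n → ∀ {a} {A : Set a} → A
m≢m+1+n m p q = contradiction (trans (sym q) p) (m+1+n≢m m)

prime[3] : Prime 3
prime[3] = from-yes (prime? 3)

-- Abstract, because the quotient would unfold to a run of Euclid's algorithm.
abstract
  prime∣sq : ∀ {p} n → Prime p → p ∣ n * n → p ∣ n
  prime∣sq n pr d = [ id , id ]′ (euclidsLemma n n pr d)

-- The quadratic kX² - knX + D has x as a root, so its other root is n - x and k·x·(n - x) = D.
-- Positivity of D gives x < n, hence a positive second root, and D < kx² makes that root smaller
-- than x.
vieta : ∀ k n x D → k * (x * x) + D ≡ k * n * x → 0 < D → D < k * (x * x) →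
        ∃ λ x′ → 0 < x′ × x′ < x × x + x′ ≡ n × k * (x′ * x′) + D ≡ k * n * x′
vieta k n x D eq 0<D D<kx² = n ∸ x , m<n⇒0<n∸m x<n , x′<x , split , eq′
  where
  open ≡-Reasoning
  kxx : ∀ k x → k * (x * x) ≡ k * x * x
  kxx = solve-∀
  swap : ∀ k n x → k * n * x ≡ k * x * n
  swap = solve-∀
  x<n : x < n
  x<n = *-cancelˡ-< (k * x) x n
    (subst₂ _<_ (kxx k x) (trans eq (swap k n x)) (m<m+n (k * (x * x)) 0<D))
  split : x + (n ∸ x) ≡ n
  split = m+[n∸m]≡n (<⇒≤ x<n)
  D≡ : D ≡ k * x * (n ∸ x)
  D≡ = +-cancelˡ-≡ (k * (x * x)) D _ (begin
    k * (x * x) + D                  ≡⟨ eq ⟩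
    k * n * x                        ≡⟨ cong (λ m → k * m * x) split ⟨
    k * (x + (n ∸ x)) * x            ≡⟨ ring k x (n ∸ x) ⟩
    k * (x * x) + k * x * (n ∸ x)    ∎)
    where
    ring : ∀ k x y → k * (x + y) * x ≡ k * (x * x) + k * x * y
    ring = solve-∀
  x′<x : n ∸ x < x
  x′<x = *-cancelˡ-< (k * x) (n ∸ x) x (subst₂ _<_ D≡ (kxx k x) D<kx²)
  eq′ : k * ((n ∸ x) * (n ∸ x)) + D ≡ k * n * (n ∸ x)
  eq′ = begin
    k * ((n ∸ x) * (n ∸ x)) + D                  ≡⟨ cong (k * ((n ∸ x) * (n ∸ x)) +_) D≡ ⟩
    k * ((n ∸ x) * (n ∸ x)) + k * x * (n ∸ x)    ≡⟨ ring k x (n ∸ x) ⟩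
    k * (x + (n ∸ x)) * (n ∸ x)                  ≡⟨ cong (λ m → k * m * (n ∸ x)) split ⟩
    k * n * (n ∸ x)                              ∎
    where
    ring : ∀ k x y → k * (y * y) + k * x * y ≡ k * (x + y) * y
    ring = solve-∀

-- Bounds under the triangle inequalities.

-- 9B(B + e) − (A + 2B + e)² is a polynomial in e, f, β with nonnegative
-- coefficients.
smallest≤3 : ∀ e f β → let A = e + f; B = A + β in 0 < A →
             ((A + B + (B + e)) * (A + B + (B + e))) ≡ 3 * A * B * (B + e) → A ≤ 3
smallest≤3 e f β 0<A eq = *-cancelˡ-≤ (3 * (B * (B + e)))
  {{>-nonZero (*-mono-≤ {1} {3} (s≤s z≤n) (*-mono-≤ 0<B (≤-trans 0<B (m≤m+n B e))))}} (begin
    3 * (B * (B + e)) * A    ≡⟨ ring₁ A B e ⟩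
    3 * A * B * (B + e)      ≡⟨ eq ⟨
    ((A + B + (B + e)) * (A + B + (B + e)))    ≤⟨ m≤m+n _ _ ⟩
    ((A + B + (B + e)) * (A + B + (B + e))) + (2 * (e * e) + 5 * (β * β) + 3 * e * f + 11 * e * β + 6 * f * β)
                             ≡⟨ ring₂ e f β ⟩
    3 * (B * (B + e)) * 3    ∎)
  where
  open ≤-Reasoning
  A = e + f
  B = A + β
  0<B : 0 < B
  0<B = ≤-trans 0<A (m≤m+n A β)
  ring₁ : ∀ A B e → 3 * (B * (B + e)) * A ≡ 3 * A * B * (B + e)
  ring₁ = solve-∀
  ring₂ : ∀ e f β →
    ((e + f + (e + f + β) + (e + f + β + e)) * (e + f + (e + f + β) + (e + f + β + e)))
      + (2 * (e * e) + 5 * (β * β) + 3 * e * f + 11 * e * β + 6 * f * β)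
    ≡ 3 * ((e + f + β) * (e + f + β + e)) * 3
  ring₂ = solve-∀

-- Only nine pairs (A, e) satisfy 0 < A ≤ 3 and e ≤ A. For each, putting B = 5 + x makes the two
-- sides differ by a quadratic in x with positive coefficients; the square is the larger side for A
-- = 1 and the smaller one for A = 2 and A = 3. The bound is sharp: the sorted triple (2, 4, 6)
-- solves the equation.
middle<5 : ∀ A B e → 0 < A → A ≤ 3 → e ≤ A →
           ((A + B + (B + e)) * (A + B + (B + e))) ≡ 3 * A * B * (B + e) → B < 5
middle<5 A B e 0<A A≤3 e≤A eq with B <? 5
... | yes B<5 = B<5
... | no B≮5 with x , refl ← m≤n⇒∃[o]m+o≡n (≮⇒≥ B≮5) = go A e 0<A A≤3 e≤A eq
  where
  go : ∀ A e → 0 < A → A ≤ 3 → e ≤ A →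
       ((A + (5 + x) + (5 + x + e)) * (A + (5 + x) + (5 + x + e))) ≡ 3 * A * (5 + x) * (5 + x + e) → 5 + x < 5
  go 1 0 _ _ _ q = m≢m+1+n _ q (ring x)
    where
    ring : ∀ x → ((1 + (5 + x) + (5 + x + 0)) * (1 + (5 + x) + (5 + x + 0)))
      ≡ 3 * 1 * (5 + x) * (5 + x + 0) + suc (45 + 14 * x + (x * x))
    ring = solve-∀
  go 1 1 _ _ _ q = m≢m+1+n _ q (ring x)
    where
    ring : ∀ x → ((1 + (5 + x) + (5 + x + 1)) * (1 + (5 + x) + (5 + x + 1)))
      ≡ 3 * 1 * (5 + x) * (5 + x + 1) + suc (53 + 15 * x + (x * x))
    ring = solve-∀
  go 2 0 _ _ _ q = m≢m+1+n _ (sym q) (ring x)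
    where
    ring : ∀ x → 3 * 2 * (5 + x) * (5 + x + 0)
      ≡ ((2 + (5 + x) + (5 + x + 0)) * (2 + (5 + x) + (5 + x + 0))) + suc (5 + 12 * x + 2 * (x * x))
    ring = solve-∀
  go 2 1 _ _ _ q = m≢m+1+n _ (sym q) (ring x)
    where
    ring : ∀ x → 3 * 2 * (5 + x) * (5 + x + 1)
      ≡ ((2 + (5 + x) + (5 + x + 1)) * (2 + (5 + x) + (5 + x + 1))) + suc (10 + 14 * x + 2 * (x * x))
    ring = solve-∀
  go 2 2 _ _ _ q = m≢m+1+n _ (sym q) (ring x)
    where
    ring : ∀ x → 3 * 2 * (5 + x) * (5 + x + 2)
      ≡ ((2 + (5 + x) + (5 + x + 2)) * (2 + (5 + x) + (5 + x + 2))) + suc (13 + 16 * x + 2 * (x * x))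
    ring = solve-∀
  go 3 0 _ _ _ q = m≢m+1+n _ (sym q) (ring x)
    where
    ring : ∀ x → 3 * 3 * (5 + x) * (5 + x + 0)
      ≡ ((3 + (5 + x) + (5 + x + 0)) * (3 + (5 + x) + (5 + x + 0))) + suc (55 + 38 * x + 5 * (x * x))
    ring = solve-∀
  go 3 1 _ _ _ q = m≢m+1+n _ (sym q) (ring x)
    where
    ring : ∀ x → 3 * 3 * (5 + x) * (5 + x + 1)
      ≡ ((3 + (5 + x) + (5 + x + 1)) * (3 + (5 + x) + (5 + x + 1))) + suc (73 + 43 * x + 5 * (x * x))
    ring = solve-∀
  go 3 2 _ _ _ q = m≢m+1+n _ (sym q) (ring x)
    where
    ring : ∀ x → 3 * 3 * (5 + x) * (5 + x + 2)
      ≡ ((3 + (5 + x) + (5 + x + 2)) * (3 + (5 + x) + (5 + x + 2))) + suc (89 + 48 * x + 5 * (x * x))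
    ring = solve-∀
  go 3 3 _ _ _ q = m≢m+1+n _ (sym q) (ring x)
    where
    ring : ∀ x → 3 * 3 * (5 + x) * (5 + x + 3)
      ≡ ((3 + (5 + x) + (5 + x + 3)) * (3 + (5 + x) + (5 + x + 3))) + suc (103 + 53 * x + 5 * (x * x))
    ring = solve-∀
  go 1 (suc (suc _)) _ _ (s≤s ()) _
  go 2 (suc (suc (suc _))) _ _ (s≤s (s≤s ())) _
  go 3 (suc (suc (suc (suc _)))) _ _ (s≤s (s≤s (s≤s ()))) _
  go (suc (suc (suc (suc _)))) _ _ (s≤s (s≤s (s≤s ()))) _ _

-- Differences replace the inequalities: β = B - A, e = C - B, and f = A - e is the slack in C ≤ A +
-- B. Then C = B + e with B ≤ 4 and e ≤ A ≤ 3.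
sorted-triangle≤7 : ∀ {A B C} → 0 < A → A ≤ B → B ≤ C → C ≤ A + B →
                    (A + B + C) * (A + B + C) ≡ 3 * A * B * C → C ≤ 7
sorted-triangle≤7 {A} {B} {C} 0<A A≤B B≤C C≤A+B eq
  with β , refl ← m≤n⇒∃[o]m+o≡n A≤B
  with e , refl ← m≤n⇒∃[o]m+o≡n B≤C
  with e≤A ← +-cancelˡ-≤ B e A (subst (B + e ≤_) (+-comm A B) C≤A+B)
  with f , refl ← m≤n⇒∃[o]m+o≡n e≤A
  = +-mono-≤ (m<1+n⇒m≤n (middle<5 A B e 0<A A≤3 e≤A eq)) (≤-trans e≤A A≤3)
  where
  A≤3 : e + f ≤ 3
  A≤3 = smallest≤3 e f β 0<A eq

-- Equation and triangle inequalities are symmetric in A, B, C, so each of the six orderings reduces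
-- to the sorted case.
triangle≤7 : ∀ {A B C} → 0 < A → 0 < B → 0 < C → A ≤ B + C → B ≤ A + C → C ≤ A + B →
             (A + B + C) * (A + B + C) ≡ 3 * A * B * C → A ≤ 7 × B ≤ 7 × C ≤ 7
triangle≤7 {A} {B} {C} 0<A 0<B 0<C A≤ B≤ C≤ eq
  with ≤-total A B | ≤-total B C | ≤-total A C
... | inj₁ A≤B | inj₁ B≤C | _ =
  let C≤7 = sorted-triangle≤7 0<A A≤B B≤C C≤ eq
  in ≤-trans A≤B (≤-trans B≤C C≤7) , ≤-trans B≤C C≤7 , C≤7
... | inj₂ B≤A | _ | inj₁ A≤C =
  let C≤7 = sorted-triangle≤7 0<B B≤A A≤C (subst (C ≤_) (+-comm A B) C≤)
              (trans (lhs A B C) (trans eq (rhs A B C)))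
  in ≤-trans A≤C C≤7 , ≤-trans (≤-trans B≤A A≤C) C≤7 , C≤7
  where
  lhs : ∀ A B C → (B + A + C) * (B + A + C) ≡ (A + B + C) * (A + B + C)
  lhs = solve-∀
  rhs : ∀ A B C → 3 * A * B * C ≡ 3 * B * A * C
  rhs = solve-∀
... | _ | inj₂ C≤B | inj₁ A≤C =
  let B≤7 = sorted-triangle≤7 0<A A≤C C≤B B≤ (trans (lhs A B C) (trans eq (rhs A B C)))
  in ≤-trans (≤-trans A≤C C≤B) B≤7 , B≤7 , ≤-trans C≤B B≤7
  where
  lhs : ∀ A B C → (A + C + B) * (A + C + B) ≡ (A + B + C) * (A + B + C)
  lhs = solve-∀
  rhs : ∀ A B C → 3 * A * B * C ≡ 3 * A * C * B
  rhs = solve-∀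
... | inj₁ A≤B | _ | inj₂ C≤A =
  let B≤7 = sorted-triangle≤7 0<C C≤A A≤B (subst (B ≤_) (+-comm A C) B≤)
              (trans (lhs A B C) (trans eq (rhs A B C)))
  in ≤-trans A≤B B≤7 , B≤7 , ≤-trans (≤-trans C≤A A≤B) B≤7
  where
  lhs : ∀ A B C → (C + A + B) * (C + A + B) ≡ (A + B + C) * (A + B + C)
  lhs = solve-∀
  rhs : ∀ A B C → 3 * A * B * C ≡ 3 * C * A * B
  rhs = solve-∀
... | inj₂ B≤A | inj₁ B≤C | inj₂ C≤A =
  let A≤7 = sorted-triangle≤7 0<B B≤C C≤A A≤ (trans (lhs A B C) (trans eq (rhs A B C)))
  in A≤7 , ≤-trans B≤A A≤7 , ≤-trans C≤A A≤7
  where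
  lhs : ∀ A B C → (B + C + A) * (B + C + A) ≡ (A + B + C) * (A + B + C)
  lhs = solve-∀
  rhs : ∀ A B C → 3 * A * B * C ≡ 3 * B * C * A
  rhs = solve-∀
... | inj₂ B≤A | inj₂ C≤B | inj₂ C≤A =
  let A≤7 = sorted-triangle≤7 0<C C≤B B≤A (subst (A ≤_) (+-comm B C) A≤)
              (trans (lhs A B C) (trans eq (rhs A B C)))
  in A≤7 , ≤-trans B≤A A≤7 , ≤-trans C≤A A≤7
  where
  lhs : ∀ A B C → (C + B + A) * (C + B + A) ≡ (A + B + C) * (A + B + C)
  lhs = solve-∀
  rhs : ∀ A B C → 3 * A * B * C ≡ 3 * C * B * A
  rhs = solve-∀

-- The Markov-type equation and its descent.

Markov : ℕ → ℕ → ℕ → ℕ → Set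
Markov g a s t = a * a + g * (s * s) + 3 * g * (t * t) ≡ 3 * g * s * t * a

1or2 : ∀ {n} → 0 < n → n ≤ 2 → n ≡ 1 ⊎ n ≡ 2
1or2 {1} _ _ = inj₁ refl
1or2 {2} _ _ = inj₂ refl
1or2 {suc (suc (suc _))} _ (s≤s (s≤s ()))

sq≤7⇒≤2 : ∀ n → n * n ≤ 7 → n ≤ 2
sq≤7⇒≤2 0 _ = z≤n
sq≤7⇒≤2 1 _ = s≤s z≤n
sq≤7⇒≤2 2 _ = s≤s (s≤s z≤n)
sq≤7⇒≤2 (suc (suc (suc n))) le =
  contradiction (≤-trans (*-mono-≤ {3} {3 + n} {3} {3 + n} (m≤m+n 3 n) (m≤m+n 3 n)) le) λ
    { (s≤s (s≤s (s≤s (s≤s (s≤s (s≤s (s≤s ()))))))) }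

-- The bounds leave only 1 and 2 as values of g, a, s and t. Of the sixteen resulting tuples,
-- evaluation refutes all but (2, 2, 1, 1).
markov-root : ∀ {g a s t} → 0 < g → 0 < a → 0 < s → 0 < t →
              a * a ≤ 7 → g * (s * s) ≤ 7 → 3 * g * (t * t) ≤ 7 →
              Markov g a s t → g ≡ 2 × a ≡ 2 × s ≡ 1 × t ≡ 1
markov-root {g} {a} {s} {t} 0<g 0<a 0<s 0<t A≤7 B≤7 C≤7 =
  go (1or2 0<g g≤2) (1or2 0<a (sq≤7⇒≤2 a A≤7)) (1or2 0<s s≤2) (1or2 0<t t≤2)
  where
  s≤2 : s ≤ 2
  s≤2 = sq≤7⇒≤2 s (≤-trans (m≤n*m (s * s) g {{>-nonZero 0<g}}) B≤7)
  t≤2 : t ≤ 2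
  t≤2 = sq≤7⇒≤2 t (≤-trans
    (m≤n*m (t * t) (3 * g) {{>-nonZero (≤-trans 0<g (m≤n*m g 3))}}) C≤7)
  g≤2 : g ≤ 2
  -- 7 is relaxed to 8 because 3g < 3 · 3 means `suc (3 * g) ≤ 9`.
  g≤2 = m<1+n⇒m≤n (*-cancelˡ-< 3 g 3 (s≤s (≤-trans
    (≤-trans (m≤m*n (3 * g) (t * t) {{>-nonZero (*-mono-≤ 0<t 0<t)}}) C≤7) (m≤m+n 7 1))))
  go : ∀ {g a s t} → g ≡ 1 ⊎ g ≡ 2 → a ≡ 1 ⊎ a ≡ 2 → s ≡ 1 ⊎ s ≡ 2 → t ≡ 1 ⊎ t ≡ 2 →
       Markov g a s t → g ≡ 2 × a ≡ 2 × s ≡ 1 × t ≡ 1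
  go (inj₂ refl) (inj₂ refl) (inj₁ refl) (inj₁ refl) _ = refl , refl , refl , refl
  go (inj₁ refl) (inj₁ refl) (inj₁ refl) (inj₁ refl) ()
  go (inj₁ refl) (inj₁ refl) (inj₁ refl) (inj₂ refl) ()
  go (inj₁ refl) (inj₁ refl) (inj₂ refl) (inj₁ refl) ()
  go (inj₁ refl) (inj₁ refl) (inj₂ refl) (inj₂ refl) ()
  go (inj₁ refl) (inj₂ refl) (inj₁ refl) (inj₁ refl) ()
  go (inj₁ refl) (inj₂ refl) (inj₁ refl) (inj₂ refl) ()
  go (inj₁ refl) (inj₂ refl) (inj₂ refl) (inj₁ refl) ()
  go (inj₁ refl) (inj₂ refl) (inj₂ refl) (inj₂ refl) ()
  go (inj₂ refl) (inj₁ refl) (inj₁ refl) (inj₁ refl) ()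
  go (inj₂ refl) (inj₁ refl) (inj₁ refl) (inj₂ refl) ()
  go (inj₂ refl) (inj₁ refl) (inj₂ refl) (inj₁ refl) ()
  go (inj₂ refl) (inj₁ refl) (inj₂ refl) (inj₂ refl) ()
  go (inj₂ refl) (inj₂ refl) (inj₁ refl) (inj₂ refl) ()
  go (inj₂ refl) (inj₂ refl) (inj₂ refl) (inj₁ refl) ()
  go (inj₂ refl) (inj₂ refl) (inj₂ refl) (inj₂ refl) ()

private
  -- These rearrangements exhibit the equation as kx² + D = knx for `vieta`: (k, n) is (1, 3gst) for
  -- x = a, (g, 3ta) for x = s, and (3g, sa) for x = t.
  sum-a : ∀ a B C → 1 * (a * a) + (B + C) ≡ a * a + B + C
  sum-a = solve-∀
  sum-s : ∀ g a s t → g * (s * s) + (a * a + 3 * g * (t * t)) ≡ a * a + g * (s * s) + 3 * g * (t * t)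
  sum-s = solve-∀
  prod-a : ∀ n a → n * a ≡ 1 * n * a
  prod-a = solve-∀
  prod-s : ∀ g a s t → 3 * g * s * t * a ≡ g * (3 * t * a) * s
  prod-s = solve-∀
  prod-t : ∀ g a s t → 3 * g * s * t * a ≡ 3 * g * (s * a) * t
  prod-t = solve-∀
  -- Squaring the equation then gives (A + B + C)² = 3ABC, the form that `triangle≤7` expects.
  prod² : ∀ g a s t → 3 * g * s * t * a * (3 * g * s * t * a)
    ≡ 3 * (a * a) * (g * (s * s)) * (3 * g * (t * t))
  prod² = solve-∀

∣-other-root : ∀ {d x x′ n} → x + x′ ≡ n → d ∣ n → d ∣ x → d ∣ x′
∣-other-root refl = ∣m+n∣m⇒∣n

-- Well-founded descent on a + s + t. The two roots for a, s and t have sums 3gst, 3ta and sa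
-- respectively. The first is even because g = 2 and the others because a is even, so each
-- replacement keeps parity. A common divisor of s and t divides 3ta and sa, so coprimality lifts
-- from the smaller solution as well.
markov-structure : ∀ {g a s t} → 0 < g → 0 < a → 0 < s → 0 < t → Acc _<_ (a + s + t) →
                   Markov g a s t → g ≡ 2 × 2 ∣ a × 2 ∤ s × 2 ∤ t × Coprime s t
markov-structure {g} {a} {s} {t} 0<g 0<a 0<s 0<t (acc rec) eq
  with g * (s * s) + 3 * g * (t * t) <? a * a
     | a * a + 3 * g * (t * t) <? g * (s * s)
     | a * a + g * (s * s) <? 3 * g * (t * t)
... | yes large | _ | _
  with a′ , 0<a′ , a′<a , sum , eq′ ← vieta 1 (3 * g * s * t) a _
         (trans (sum-a a (g * (s * s)) _) (trans eq (prod-a (3 * g * s * t) a)))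
         (≤-trans (*-mono-≤ 0<g (*-mono-≤ 0<s 0<s)) (m≤m+n _ _))
         (subst (g * (s * s) + 3 * g * (t * t) <_) (sym (*-identityˡ (a * a))) large)
  with refl , 2∣a′ , odd-s , odd-t , cop ←
         markov-structure 0<g 0<a′ 0<s 0<t
           (rec (+-monoˡ-< t (+-monoˡ-< s a′<a)))
           (trans (sym (sum-a a′ (g * (s * s)) _)) (trans eq′ (sym (prod-a (3 * g * s * t) a′))))
  = refl
  , ∣-other-root (trans (+-comm a′ a) sum)
      (∣m⇒∣m*n t (∣m⇒∣m*n s (divides 3 refl))) 2∣a′
  , odd-s , odd-t , cop
... | no _ | yes large | _
  with s′ , 0<s′ , s′<s , sum , eq′ ← vieta g (3 * t * a) s _
         (trans (sum-s g a s t) (trans eq (prod-s g a s t)))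
         (≤-trans (*-mono-≤ 0<a 0<a) (m≤m+n _ _)) large
  with refl , 2∣a , odd-s′ , odd-t , cop ←
         markov-structure 0<g 0<a 0<s′ 0<t
           (rec (+-monoˡ-< t (+-monoʳ-< a s′<s)))
           (trans (sym (sum-s g a s′ t)) (trans eq′ (sym (prod-s g a s′ t))))
  = refl , 2∣a
  , (λ 2∣s → odd-s′ (∣-other-root sum (∣n⇒∣m*n (3 * t) 2∣a) 2∣s))
  , odd-t
  , (λ (d∣s , d∣t) → cop (∣-other-root sum (∣m⇒∣m*n a (∣n⇒∣m*n 3 d∣t)) d∣s , d∣t))
... | no _ | no _ | yes large
  with t′ , 0<t′ , t′<t , sum , eq′ ← vieta (3 * g) (s * a) t _
         (trans (+-comm (3 * g * (t * t)) _) (trans eq (prod-t g a s t)))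
         (≤-trans (*-mono-≤ 0<a 0<a) (m≤m+n _ _)) large
  with refl , 2∣a , odd-s , odd-t′ , cop ←
         markov-structure 0<g 0<a 0<s 0<t′
           (rec (+-monoʳ-< (a + s) t′<t))
           (trans (+-comm _ (3 * g * (t′ * t′))) (trans eq′ (sym (prod-t g a s t′))))
  = refl , 2∣a , odd-s
  , (λ 2∣t → odd-t′ (∣-other-root sum (∣n⇒∣m*n s 2∣a) 2∣t))
  , (λ (d∣s , d∣t) → cop (d∣s , ∣-other-root sum (∣m⇒∣m*n a d∣s) d∣t))
... | no A≯ | no B≯ | no C≯
  with A≤7 , B≤7 , C≤7 ← triangle≤7 {a * a} {g * (s * s)} {3 * g * (t * t)}
         (*-mono-≤ 0<a 0<a) (*-mono-≤ 0<g (*-mono-≤ 0<s 0<s))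
         (*-mono-≤ {1} {3 * g} (≤-trans 0<g (m≤n*m g 3)) (*-mono-≤ 0<t 0<t))
         (≮⇒≥ A≯) (≮⇒≥ B≯) (≮⇒≥ C≯)
         (trans (cong₂ _*_ eq eq) (prod² g a s t))
  with refl , refl , refl , refl ← markov-root 0<g 0<a 0<s 0<t A≤7 B≤7 C≤7 eq
  = refl , divides 1 refl , 2∤1 , 2∤1 , (λ (d∣1 , _) → ∣1⇒≡1 d∣1)
  where
  2∤1 : 2 ∤ 1
  2∤1 2∣1 = contradiction (∣1⇒≡1 2∣1) λ ()

-- From the square to the factors u and v.

sq-cancel-≤ : ∀ m n → m * m ≤ n * n → m ≤ n
sq-cancel-≤ m n le = ≮⇒≥ λ n<m → <⇒≱ (*-mono-< n<m n<m) le

sq-injective : ∀ m n → m * m ≡ n * n → m ≡ n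
sq-injective m n eq =
  ≤-antisym (sq-cancel-≤ m n (≤-reflexive eq)) (sq-cancel-≤ n m (≤-reflexive (sym eq)))

common-factor : ∀ u c → 0 < c → ∃ λ h → ∃₂ λ s t → u ≡ s * h × c ≡ t * h × Coprime s t
common-factor u c@(suc _) 0<c =
  gcd u c , u / gcd u c , c / gcd u c ,
  sym (m/n*n≡m (gcd[m,n]∣m u c)) , sym (m/n*n≡m (gcd[m,n]∣n u c)) , coprime-/gcd u c
  where instance
    gcd≢0 : NonZero (gcd u c)
    gcd≢0 = ≢-nonZero (gcd[m,n]≢0 u c (inj₂ λ ()))

-- Write u / c = s / t in lowest terms.
product-3sq : ∀ u v c → 0 < c → u * v ≡ 3 * (c * c) →
  ∃ λ g → ∃₂ λ s t → c ≡ g * s * t × u + v ≡ g * (s * s) + 3 * g * (t * t)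
product-3sq u v c 0<c eq with common-factor u c 0<c
... | 0 , _ , t , _ , refl , _ = contradiction (subst (0 <_) (*-zeroʳ t) 0<c) λ ()
... | h@(suc _) , s , t , refl , refl , cop = go (euclidsLemma k s prime[3] (divides h (trans (sym 3h≡ks) (*-comm 3 h))))
  where
  sv : s * v ≡ 3 * h * (t * t)
  sv = *-cancelˡ-≡ _ _ h (trans (ring₁ h s v) (trans eq (ring₂ h t)))
    where
    ring₁ : ∀ h s v → h * (s * v) ≡ s * h * v
    ring₁ = solve-∀
    ring₂ : ∀ h t → 3 * (t * h * (t * h)) ≡ h * (3 * h * (t * t))
    ring₂ = solve-∀
  -- Since sv = 3ht² and s is coprime to t, removing t twice leaves s dividing 3h. With 3h = ks this
  -- yields v = kt².
  s∣3h : s ∣ 3 * h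
  s∣3h = coprime-divisor cop (coprime-divisor cop
    (divides v (trans (ring t (3 * h)) (trans (sym sv) (*-comm s v)))))
    where
    ring : ∀ t x → t * (t * x) ≡ x * (t * t)
    ring = solve-∀
  k : ℕ
  k = _∣_.quotient s∣3h
  3h≡ks : 3 * h ≡ k * s
  3h≡ks = _∣_.equality s∣3h
  instance
    s≢0 : NonZero s
    s≢0 = ≢-nonZero λ { refl → contradiction (trans 3h≡ks (*-zeroʳ k)) λ () }
  v≡ : v ≡ k * (t * t)
  v≡ = *-cancelˡ-≡ _ _ s (trans sv (trans (cong (_* (t * t)) 3h≡ks) (ring k s t)))
    where
    ring : ∀ k s t → k * s * (t * t) ≡ s * (k * (t * t))
    ring = solve-∀
  Goal : Set
  Goal = ∃ λ g → ∃₂ λ s′ t′ →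
    t * h ≡ g * s′ * t′ × s * h + v ≡ g * (s′ * s′) + 3 * g * (t′ * t′)
  go : 3 ∣ k ⊎ 3 ∣ s → Goal
  -- If k = 3g then h = gs, so u = gs² and v = 3gt².
  go (inj₁ (divides g k≡)) = g , s , t
    , trans (cong (t *_) h≡) (*-comm t _)
    , cong₂ _+_ (trans (cong (s *_) h≡) (ring₂ g s))
        (trans v≡ (cong (_* (t * t)) (trans k≡ (*-comm g 3))))
    where
    ring₁ : ∀ g s → g * 3 * s ≡ 3 * (g * s)
    ring₁ = solve-∀
    ring₂ : ∀ g s → s * (g * s) ≡ g * (s * s)
    ring₂ = solve-∀
    h≡ : h ≡ g * s
    h≡ = *-cancelˡ-≡ _ _ 3 (trans 3h≡ks (trans (cong (_* s) k≡) (ring₁ g s)))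
  -- If s = 3s′ then h = ks′, so u = 3ks′² and v = kt². The two summands exchange their forms, which
  -- makes t and s′ the new pair.
  go (inj₂ (divides s′ s≡)) = k , t , s′
    , trans (cong (t *_) h≡) (ring₂ k s′ t)
    , trans (cong₂ _+_ (trans (cong₂ _*_ s≡ h≡) (ring₃ k s′)) v≡) (+-comm _ (k * (t * t)))
    where
    ring₁ : ∀ k s → k * (s * 3) ≡ 3 * (k * s)
    ring₁ = solve-∀
    ring₂ : ∀ k s t → t * (k * s) ≡ k * t * s
    ring₂ = solve-∀
    ring₃ : ∀ k s → s * 3 * (k * s) ≡ 3 * k * (s * s)
    ring₃ = solve-∀
    h≡ : h ≡ k * s′
    h≡ = *-cancelˡ-≡ _ _ 3 (trans 3h≡ks (trans (cong (k *_) s≡) (ring₁ k s′)))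

-- Modulo 3 the equation forces k = 3m. Dividing by 3 leaves 3m² + 4n² = 3p², which forces n = 3c,
-- and a second division by 3 is then possible. It is applied with p = ab and n = a + b.
divide-by-3 : ∀ p n k → k * k + 12 * (n * n) ≡ 9 * (p * p) →
  ∃₂ λ c m → n ≡ 3 * c × m * m + 12 * (c * c) ≡ p * p
divide-by-3 p n k eq = c , m , n≡ ,
  *-cancelˡ-≡ _ _ 3 (trans (ring₃ m c)
    (trans (cong (λ x → 3 * (m * m) + 4 * (x * x)) (sym n≡)) eq₃))
  where
  3∣k : 3 ∣ k
  3∣k = prime∣sq k prime[3] (∣-other-root (+-comm _ (k * k))
    (subst (3 ∣_) (sym eq) (∣m⇒∣m*n (p * p) (divides 3 refl)))
    (∣m⇒∣m*n (n * n) (divides 4 refl)))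
  m : ℕ
  m = _∣_.quotient 3∣k
  ring₁ : ∀ m n → 3 * (3 * (m * m) + 4 * (n * n)) ≡ m * 3 * (m * 3) + 12 * (n * n)
  ring₁ = solve-∀
  ring₂ : ∀ p → 9 * (p * p) ≡ 3 * (3 * (p * p))
  ring₂ = solve-∀
  eq₃ : 3 * (m * m) + 4 * (n * n) ≡ 3 * (p * p)
  eq₃ = *-cancelˡ-≡ _ _ 3 (trans (ring₁ m n)
    (trans (cong (λ x → x * x + 12 * (n * n)) (sym (_∣_.equality 3∣k))) (trans eq (ring₂ p))))
  split : ∀ m n → 3 * (m * m + n * n) + n * n ≡ 3 * (m * m) + 4 * (n * n)
  split = solve-∀
  3∣n : 3 ∣ n
  3∣n = prime∣sq n prime[3] (∣-other-root (trans (split m n) eq₃) (m∣m*n (p * p)) (m∣m*n (m * m + n * n)))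
  c : ℕ
  c = _∣_.quotient 3∣n
  n≡ : n ≡ 3 * c
  n≡ = trans (_∣_.equality 3∣n) (*-comm c 3)
  ring₃ : ∀ m c → 3 * (m * m + 12 * (c * c)) ≡ 3 * (m * m) + 4 * (3 * c * (3 * c))
  ring₃ = solve-∀

private
  expand : ∀ m d → (m + d) * (m + d) ≡ m * m + (2 * (m * d) + d * d)
  expand = solve-∀

-- p² − m² = (p − m)(p + m), and both factors are even.
difference-of-squares : ∀ p m c → m * m + 12 * (c * c) ≡ p * p →
  ∃₂ λ u v → u * v ≡ 3 * (c * c) × u + v ≡ p
difference-of-squares p m c eq
  with d , refl ← m≤n⇒∃[o]m+o≡n (sq-cancel-≤ m p (subst (m * m ≤_) eq (m≤m+n _ _)))
  with eq′ ← +-cancelˡ-≡ (m * m) (12 * (c * c)) (2 * (m * d) + d * d) (trans eq (expand m d))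
  -- Here 12c² = 2md + d², so d² and hence d is even.
  with divides w refl ← prime∣sq d prime[2] (∣-other-root (sym eq′)
         (∣m⇒∣m*n (c * c) (divides 6 refl)) (m∣m*n (m * d)))
  -- The witnesses are w = (p - m)/2 and m + w = (p + m)/2.
  = w , m + w , *-cancelˡ-≡ _ _ 4 (trans (ring₁ m w) (trans (sym eq′) (ring₂ c))) , ring₃ m w
  where
  ring₂ : ∀ c → 12 * (c * c) ≡ 4 * (3 * (c * c))
  ring₂ = solve-∀
  ring₁ : ∀ m w → 4 * (w * (m + w)) ≡ 2 * (m * (w * 2)) + w * 2 * (w * 2)
  ring₁ = solve-∀
  ring₃ : ∀ m w → w + (m + w) ≡ m + w * 2
  ring₃ = solve-∀

-- The parameters q, r, s, t of a pair.

-- The equations say that q and r are the roots of 2x² − 6stx + s² + 3t².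
record Params (q r s t : ℕ) : Set where
  constructor mkParams
  field
    0<s     : 0 < s
    0<t     : 0 < t
    odd-s   : Odd s
    odd-t   : Odd t
    coprime : Coprime s t
    sum     : q + r ≡ 3 * s * t
    product : 2 * (q * r) ≡ s * s + 3 * (t * t)

-- Expanding a(a + b) as a² + ab shows that (a, s, t) solves the Markov-type equation, so g = 2 and
-- a is even. Then b is even because a + b = 6st, and both given equations can be halved.
sum-product⇒params : ∀ a b g s t → 0 < a → 0 < b →
  a + b ≡ 3 * g * s * t → a * b ≡ g * (s * s) + 3 * g * (t * t) →
  ∃₂ λ q r → ∃₂ λ s t → a ≡ 2 * q × b ≡ 2 * r × Params q r s t
sum-product⇒params a b g s t 0<a 0<b a+b≡3gst ab≡ =
  finish (markov-structure 0<g 0<a 0<s 0<t (<-wellFounded (a + s + t)) markov)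
  where
  0<3gst : 0 < 3 * g * s * t
  0<3gst = subst (0 <_) a+b≡3gst (≤-trans 0<a (m≤m+n a b))
  0<t : 0 < t
  0<t = n≢0⇒n>0 λ { refl → contradiction (subst (0 <_) (*-zeroʳ (3 * g * s)) 0<3gst) λ () }
  0<s : 0 < s
  0<s = n≢0⇒n>0 λ { refl → contradiction (subst (λ x → 0 < x * t) (*-zeroʳ (3 * g)) 0<3gst) λ () }
  0<g : 0 < g
  0<g = n≢0⇒n>0 λ { refl → contradiction 0<3gst λ () }
  markov : Markov g a s t
  markov = begin
    a * a + g * (s * s) + 3 * g * (t * t)     ≡⟨ +-assoc (a * a) _ _ ⟩
    a * a + (g * (s * s) + 3 * g * (t * t))   ≡⟨ cong (a * a +_) ab≡ ⟨
    a * a + a * b                             ≡⟨ ring a b ⟩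
    (a + b) * a                               ≡⟨ cong (_* a) a+b≡3gst ⟩
    3 * g * s * t * a                         ∎
    where
    open ≡-Reasoning
    ring : ∀ a b → a * a + a * b ≡ (a + b) * a
    ring = solve-∀
  finish : g ≡ 2 × 2 ∣ a × 2 ∤ s × 2 ∤ t × Coprime s t →
    ∃₂ λ q r → ∃₂ λ s t → a ≡ 2 * q × b ≡ 2 * r × Params q r s t
  finish (refl , divides q a≡ , odd-s , odd-t , cop) =
    q , r , s , t , a≡2q , b≡2r , mkParams 0<s 0<t odd-s odd-t cop
    (*-cancelˡ-≡ _ _ 2 (trans (*-distribˡ-+ 2 q r)
        (trans (cong₂ _+_ (sym a≡2q) (sym b≡2r)) (trans a+b≡3gst (ring₁ s t)))))
    (*-cancelˡ-≡ _ _ 2 (trans (ring₂ q r)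
        (trans (cong₂ _*_ (sym a≡2q) (sym b≡2r)) (trans ab≡ (ring₃ s t)))))
    where
    2∣b : 2 ∣ b
    2∣b = ∣-other-root a+b≡3gst (∣m⇒∣m*n t (∣m⇒∣m*n s (divides 3 refl))) (divides q a≡)
    r : ℕ
    r = _∣_.quotient 2∣b
    a≡2q : a ≡ 2 * q
    a≡2q = trans a≡ (*-comm q 2)
    b≡2r : b ≡ 2 * r
    b≡2r = trans (_∣_.equality 2∣b) (*-comm r 2)
    ring₁ : ∀ s t → 3 * 2 * s * t ≡ 2 * (3 * s * t)
    ring₁ = solve-∀
    ring₂ : ∀ q r → 2 * (2 * (q * r)) ≡ 2 * q * (2 * r)
    ring₂ = solve-∀
    ring₃ : ∀ s t → 2 * (s * s) + 3 * 2 * (t * t) ≡ 2 * (s * s + 3 * (t * t))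
    ring₃ = solve-∀

square⇒params : ∀ a b k → 0 < a → 0 < b →
  k * k + 12 * ((a + b) * (a + b)) ≡ 9 * (a * b * (a * b)) →
  ∃₂ λ q r → ∃₂ λ s t → a ≡ 2 * q × b ≡ 2 * r × Params q r s t
square⇒params a b k 0<a 0<b eq = step₁ (divide-by-3 (a * b) (a + b) k eq)
  where
  Goal : Set
  Goal = ∃₂ λ q r → ∃₂ λ s t → a ≡ 2 * q × b ≡ 2 * r × Params q r s t
  step₃ : ∀ c u v → a + b ≡ 3 * c → u + v ≡ a * b →
    (∃ λ g → ∃₂ λ s t → c ≡ g * s * t × u + v ≡ g * (s * s) + 3 * g * (t * t)) → Goal
  step₃ _ _ _ a+b≡ u+v≡ (g , s , t , c≡ , sum) = sum-product⇒params a b g s t 0<a 0<b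
    (trans a+b≡ (trans (cong (3 *_) c≡) (ring g s t))) (trans (sym u+v≡) sum)
    where
    ring : ∀ g s t → 3 * (g * s * t) ≡ 3 * g * s * t
    ring = solve-∀
  step₂ : ∀ c → a + b ≡ 3 * c → (∃₂ λ u v → u * v ≡ 3 * (c * c) × u + v ≡ a * b) → Goal
  step₂ c a+b≡ (u , v , uv≡ , u+v≡) = step₃ c u v a+b≡ u+v≡ (product-3sq u v c
    (*-cancelˡ-< 3 0 c (subst (0 <_) a+b≡ (≤-trans 0<a (m≤m+n a b)))) uv≡)
  step₁ : (∃₂ λ c m → a + b ≡ 3 * c × m * m + 12 * (c * c) ≡ a * b * (a * b)) → Goal
  step₁ (c , m , a+b≡ , eq₁) = step₂ c a+b≡ (difference-of-squares (a * b) m c eq₁)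

-- Divisibility by 3 and coprimality of q and r.

3∤2 : 3 ∤ 2
3∤2 = from-no (3 ∣? 2)

-- Eliminating r gives 2q² + s² + 3t² = 6qst. If 3 divides s, it divides q; then all terms except
-- 3t² are multiples of 9, so 3 divides t as well, against coprimality.
params⇒3∤s : ∀ {q r s t} → Params q r s t → 3 ∤ s
params⇒3∤s {q} {r} {s} {t} (mkParams _ _ _ _ cop sum prod) 3∣s@(divides s′ refl) =
  contradiction (cop (3∣s , 3∣t)) λ ()
  where
  quad : 2 * (q * q) + (s * s + 3 * (t * t)) ≡ 2 * q * (3 * s * t)
  quad = trans (cong (2 * (q * q) +_) (sym prod)) (trans (ring q r) (cong (2 * q *_) sum))
    where
    ring : ∀ q r → 2 * (q * q) + 2 * (q * r) ≡ 2 * q * (q + r)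
    ring = solve-∀
  3∣2q² : 3 ∣ 2 * (q * q)
  3∣2q² = ∣-other-root (trans (+-comm _ (2 * (q * q))) quad)
    (∣n⇒∣m*n (2 * q) (∣m⇒∣m*n t (m∣m*n s)))
    (∣m∣n⇒∣m+n (∣m⇒∣m*n s 3∣s) (m∣m*n (t * t)))
  3∣q : 3 ∣ q
  3∣q = [ (λ 3∣2 → contradiction 3∣2 3∤2) , prime∣sq q prime[3] ]′ (euclidsLemma 2 (q * q) prime[3] 3∣2q²)
  3∣t : 3 ∣ t
  3∣t with divides q′ refl ← 3∣q = prime∣sq t prime[3]
    (∣-other-root (*-cancelˡ-≡ _ _ 3 (trans (ring₁ q′ s′ t) (trans quad (ring₂ q′ s′ t))))
      (m∣m*n (6 * q′ * (s′ * t))) (m∣m*n (2 * (q′ * q′) + s′ * s′)))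
    where
    ring₁ : ∀ q s t → 3 * (3 * (2 * (q * q) + s * s) + t * t)
      ≡ 2 * (q * 3 * (q * 3)) + (s * 3 * (s * 3) + 3 * (t * t))
    ring₁ = solve-∀
    ring₂ : ∀ q s t → 2 * (q * 3) * (3 * (s * 3) * t) ≡ 3 * (3 * (6 * q * (s * t)))
    ring₂ = solve-∀

-- A common divisor d of q and r divides both s² + 3t² and 3st. A common divisor of d and s divides
-- 3t² and is coprime to t, so it divides 3, and it is 1 because 3 ∤ s. Thus d is coprime to s, so d
-- divides 3t, then s², then s, which leaves d = 1.
params⇒coprime : ∀ {q r s t} → Params q r s t → Coprime q r
params⇒coprime {q} {r} {s} {t} P@(mkParams _ _ _ _ cop sum prod) {d} (d∣q , d∣r) =
  d⊥s (∣-refl , coprime-divisor d⊥s d∣s²)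
  where
  d∣s²+3t² : d ∣ s * s + 3 * (t * t)
  d∣s²+3t² = subst (d ∣_) prod (∣n⇒∣m*n 2 (∣m⇒∣m*n r d∣q))
  d⊥s : Coprime d s
  d⊥s {e} (e∣d , e∣s) = [ id , (λ { refl → contradiction e∣s (params⇒3∤s P) }) ]′
    (prime⇒irreducible prime[3] (coprime-divisor e⊥t (coprime-divisor e⊥t
      (subst (e ∣_) (ring t) (∣-other-root refl (∣-trans e∣d d∣s²+3t²) (∣m⇒∣m*n s e∣s))))))
    where
    e⊥t : Coprime e t
    e⊥t (f∣e , f∣t) = cop (∣-trans f∣e e∣s , f∣t)
    ring : ∀ t → 3 * (t * t) ≡ t * (t * 3)
    ring = solve-∀
  d∣3t : d ∣ 3 * t
  d∣3t = coprime-divisor d⊥s (subst (d ∣_) (trans sum (ring s t)) (∣m∣n⇒∣m+n d∣q d∣r))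
    where
    ring : ∀ s t → 3 * s * t ≡ s * (3 * t)
    ring = solve-∀
  d∣s² : d ∣ s * s
  d∣s² = ∣-other-root (+-comm _ (s * s)) d∣s²+3t²
    (subst (d ∣_) (*-assoc 3 t t) (∣m⇒∣m*n t d∣3t))

-- The product ab = 2(s² + 3t²) is congruent to 2s² modulo 3.
params⇒3∤ab : ∀ {q r s t} → Params q r s t → 3 ∤ 2 * q * (2 * r)
params⇒3∤ab {q} {r} {s} {t} P@(mkParams _ _ _ _ _ _ prod) 3∣ab =
  [ 3∤2 , params⇒3∤s P ∘ prime∣sq s prime[3] ]′ (euclidsLemma 2 (s * s) prime[3]
    (∣-other-root (ring₂ s t)
      (subst (3 ∣_) (trans (ring₁ q r) (cong (2 *_) prod)) 3∣ab) (m∣m*n (2 * (t * t)))))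
  where
  ring₁ : ∀ q r → 2 * q * (2 * r) ≡ 2 * (2 * (q * r))
  ring₁ = solve-∀
  ring₂ : ∀ s t → 3 * (2 * (t * t)) + 2 * (s * s) ≡ 2 * (s * s + 3 * (t * t))
  ring₂ = solve-∀

-- Integer subtraction and the equations of `Corresponds`.

module +-group = GroupProperties (AbelianGroup.group ℤₚ.+-0-abelianGroup)

difference⇒sum : ∀ k {m n} → ℤ.+ k ≡ ℤ.+ m ℤ.- ℤ.+ n → k + n ≡ m
difference⇒sum k {m} {n} eq = ℤₚ.+-injective
  (trans (cong (ℤ._+ ℤ.+ n) eq) (+-group.//-rightDividesˡ (ℤ.+ n) (ℤ.+ m)))

sum⇒difference : ∀ k {m n} → k + n ≡ m → ℤ.+ k ≡ ℤ.+ m ℤ.- ℤ.+ n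
sum⇒difference k {m} {n} refl = sym (+-group.//-rightDividesʳ (ℤ.+ n) (ℤ.+ k))

ℤ-square : ∀ k → k ℤ.^ 2 ≡ ℤ.+ (ℤ.∣ k ∣ * ℤ.∣ k ∣)
ℤ-square k = trans (cong (k ℤ.*_) (ℤₚ.*-identityʳ k)) (go k)
  where
  go : ∀ k → k ℤ.* k ≡ ℤ.+ (ℤ.∣ k ∣ * ℤ.∣ k ∣)
  go (ℤ.+ n) = sym (ℤₚ.pos-* n n)
  go ℤ.-[1+ n ] = refl

-- With q + r = 3st the term 6stq becomes 2q(q + r), and cancelling 2q² leaves the product equation.
corresponds⇒params : ∀ q r s t → Corresponds q r (s , t) → Params q r s t
corresponds⇒params q r s t (0<s , 0<t , odd-s , odd-t , cop , eq , _ , r≡) =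
  mkParams 0<s 0<t odd-s odd-t cop sum (+-cancelʳ-≡ (2 * (q * q)) _ _ (begin
    2 * (q * r) + 2 * (q * q)              ≡⟨ ring₁ q r ⟩
    2 * q * (q + r)                        ≡⟨ cong (2 * q *_) sum ⟩
    2 * q * (3 * s * t)                    ≡⟨ ring₂ q s t ⟩
    6 * s * t * q                          ≡⟨ eq ⟨
    s ^ 2 + 3 * t ^ 2 + 2 * q ^ 2          ≡⟨ ring₃ q s t ⟩
    s * s + 3 * (t * t) + 2 * (q * q)      ∎))
  where
  open ≡-Reasoning
  sum : q + r ≡ 3 * s * t
  sum = trans (+-comm q r) (difference⇒sum r r≡)
  ring₁ : ∀ q r → 2 * (q * r) + 2 * (q * q) ≡ 2 * q * (q + r)
  ring₁ = solve-∀
  ring₂ : ∀ q s t → 2 * q * (3 * s * t) ≡ 6 * s * t * q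
  ring₂ = solve-∀
  -- x * (x * 1) is x ^ 2 unfolded: solve-∀ does not handle _^_.
  ring₃ : ∀ q s t → s * (s * 1) + 3 * (t * (t * 1)) + 2 * (q * (q * 1))
    ≡ s * s + 3 * (t * t) + 2 * (q * q)
  ring₃ = solve-∀

-- `Params` is symmetric in q and r, so their order has to be supplied separately.
params⇒corresponds : ∀ {q r s t} → q ≤ r → Params q r s t → Corresponds q r (s , t)
params⇒corresponds {q} {r} {s} {t} q≤r (mkParams 0<s 0<t odd-s odd-t cop sum prod) =
  0<s , 0<t , odd-s , odd-t , cop , (begin
    s ^ 2 + 3 * t ^ 2 + 2 * q ^ 2          ≡⟨ ring₁ q s t ⟩
    s * s + 3 * (t * t) + 2 * (q * q)      ≡⟨ cong (_+ 2 * (q * q)) prod ⟨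
    2 * (q * r) + 2 * (q * q)              ≡⟨ ring₂ q r ⟩
    2 * q * (q + r)                        ≡⟨ cong (2 * q *_) sum ⟩
    2 * q * (3 * s * t)                    ≡⟨ ring₃ q s t ⟩
    6 * s * t * q                          ∎)
  , q≤r , sum⇒difference r (trans (+-comm r q) sum)
  where
  open ≡-Reasoning
  ring₁ : ∀ q s t → s * (s * 1) + 3 * (t * (t * 1)) + 2 * (q * (q * 1))
    ≡ s * s + 3 * (t * t) + 2 * (q * q)
  ring₁ = solve-∀
  ring₂ : ∀ q r → 2 * (q * r) + 2 * (q * q) ≡ 2 * q * (q + r)
  ring₂ = solve-∀
  ring₃ : ∀ q s t → 2 * q * (3 * s * t) ≡ 6 * s * t * q
  ring₃ = solve-∀

-- Uniqueness of s and t.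

same-sum-product : ∀ x y x′ y′ → x + y ≡ x′ + y′ → x * y ≡ x′ * y′ → x ≡ x′ ⊎ x ≡ y′
same-sum-product x y x′ y′ sum prod =
  [ (λ x≤x′ → ordered x y x′ y′ x≤x′ sum prod)
  , (λ x′≤x → [ inj₁ ∘ sym , (λ x′≡y → inj₂ (+-cancelʳ-≡ y x y′
      (trans sum (trans (+-comm x′ y′) (cong (y′ +_) x′≡y))))) ]′
      (ordered x′ y′ x y x′≤x (sym sum) (sym prod))) ]′ (≤-total x x′)
  where
  ordered : ∀ x y x′ y′ → x ≤ x′ → x + y ≡ x′ + y′ → x * y ≡ x′ * y′ → x ≡ x′ ⊎ x ≡ y′
  ordered x y x′ y′ x≤x′ sum prod
    with m≤n⇒∃[o]m+o≡n x≤x′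
  ... | zero , refl = inj₁ (sym (+-identityʳ x))
  -- Here x′ = x + d with d > 0, hence y = d + y′. Equal products give xd = y′d, so x = y′.
  ... | d@(suc _) , refl with refl ← +-cancelˡ-≡ x y (d + y′) (trans sum (+-assoc x d y′)) =
    inj₂ (*-cancelʳ-≡ x y′ d (+-cancelʳ-≡ (x * y′) _ _
      (trans (ring₁ x d y′) (trans prod (ring₂ x d y′)))))
    where
    ring₁ : ∀ x d y → x * d + x * y ≡ x * (d + y)
    ring₁ = solve-∀
    ring₂ : ∀ x d y → (x + d) * y ≡ y * d + x * y
    ring₂ = solve-∀

-- The numbers s² and 3t² have sum 2qr, and three times their product is (q + r)². The exchanged
-- case s² = 3t′² would make 3 divide s; otherwise s = s′, and 3st = q + r determines t.
params-unique : ∀ {q r s t s′ t′} → Params q r s t → Params q r s′ t′ → (s , t) ≡ (s′ , t′)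
params-unique {q} {r} {s} {t} {s′} {t′} P@(mkParams 0<s _ _ _ _ sum prod) (mkParams _ _ _ _ _ sum′ prod′) =
  [ (λ s²≡s′² → same (sq-injective s s′ s²≡s′²))
  , (λ s²≡3t′² → contradiction
      (prime∣sq s prime[3] (subst (3 ∣_) (sym s²≡3t′²) (m∣m*n (t′ * t′))))
      (params⇒3∤s P)) ]′
  (same-sum-product (s * s) (3 * (t * t)) (s′ * s′) (3 * (t′ * t′)) (trans (sym prod) prod′)
    (*-cancelˡ-≡ _ _ 3 (trans (ring s t) (trans (cong (λ x → x * x) 3st≡) (sym (ring s′ t′))))))
  where
  3st≡ : 3 * s * t ≡ 3 * s′ * t′
  3st≡ = trans (sym sum) sum′
  ring : ∀ s t → 3 * (s * s * (3 * (t * t))) ≡ 3 * s * t * (3 * s * t)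
  ring = solve-∀
  same : s ≡ s′ → (s , t) ≡ (s′ , t′)
  same refl = cong (s ,_) (*-cancelˡ-≡ t t′ (3 * s) {{>-nonZero (≤-trans 0<s (m≤n*m s 3))}} 3st≡)

-- From the parameters back to a square.

params⇒q≢r : ∀ {q r s t} → Params q r s t → q ≢ r
params⇒q≢r {q} {s = s} {t} (mkParams _ _ odd-s odd-t _ sum _) refl =
  -- If q = r, then 3st = 2q is even although 3, s and t are odd.
  [ [ 2∤3 , odd-s ]′ ∘ euclidsLemma 3 s prime[2] , odd-t ]′
    (euclidsLemma (3 * s) t prime[2] (divides q (trans (sym sum) (ring q))))
  where
  2∤3 : 2 ∤ 3
  2∤3 = from-no (2 ∣? 3)
  ring : ∀ q → q + q ≡ q * 2
  ring = solve-∀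

∣-∣-square : ∀ x y → ∣ x - y ∣ * ∣ x - y ∣ + 4 * (x * y) ≡ (x + y) * (x + y)
∣-∣-square x y = [ below x y , (λ y≤x → trans
    (cong₂ (λ d p → d * d + 4 * p) (∣-∣-comm x y) (*-comm x y))
    (trans (below y x y≤x) (cong (λ z → z * z) (+-comm y x)))) ]′ (≤-total x y)
  where
  ring : ∀ x d → d * d + 4 * (x * (x + d)) ≡ (x + (x + d)) * (x + (x + d))
  ring = solve-∀
  below : ∀ x y → x ≤ y → ∣ x - y ∣ * ∣ x - y ∣ + 4 * (x * y) ≡ (x + y) * (x + y)
  below x y x≤y with d , refl ← m≤n⇒∃[o]m+o≡n x≤y
    rewrite ∣m-m+n∣≡n x d = ring x d

-- From ab = 2(s² + 3t²) and a + b = 6st, the difference 9a²b² - 12(a + b)² is 36((s² + 3t²)² - 4 ·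
-- s² · 3t²) = 36(s² - 3t²)², which explains the choice of k.
params⇒square : ∀ {q r s t} → Params q r s t →
  let a = 2 * q; b = 2 * r; k = 6 * ∣ s * s - 3 * (t * t) ∣ in
  k * k + 12 * ((a + b) * (a + b)) ≡ 9 * (a * b * (a * b))
params⇒square {q} {r} {s} {t} (mkParams _ _ _ _ _ sum prod) = begin
  6 * d * (6 * d) + 12 * ((2 * q + 2 * r) * (2 * q + 2 * r))  ≡⟨ ring₁ d q r ⟩
  36 * (d * d) + 48 * ((q + r) * (q + r))
    ≡⟨ cong (λ x → 36 * (d * d) + 48 * (x * x)) sum ⟩
  36 * (d * d) + 48 * (3 * s * t * (3 * s * t))               ≡⟨ ring₂ d s t ⟩
  36 * (d * d + 4 * (s * s * (3 * (t * t))))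
    ≡⟨ cong (36 *_) (∣-∣-square (s * s) (3 * (t * t))) ⟩
  36 * ((s * s + 3 * (t * t)) * (s * s + 3 * (t * t)))        ≡⟨ cong (λ x → 36 * (x * x)) prod ⟨
  36 * (2 * (q * r) * (2 * (q * r)))                          ≡⟨ ring₃ q r ⟩
  9 * (2 * q * (2 * r) * (2 * q * (2 * r)))                   ∎
  where
  open ≡-Reasoning
  d : ℕ
  d = ∣ s * s - 3 * (t * t) ∣
  ring₁ : ∀ d q r → 6 * d * (6 * d) + 12 * ((2 * q + 2 * r) * (2 * q + 2 * r))
    ≡ 36 * (d * d) + 48 * ((q + r) * (q + r))
  ring₁ = solve-∀
  ring₂ : ∀ d s t → 36 * (d * d) + 48 * (3 * s * t * (3 * s * t))
    ≡ 36 * (d * d + 4 * (s * s * (3 * (t * t))))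
  ring₂ = solve-∀
  ring₃ : ∀ q r → 36 * (2 * (q * r) * (2 * (q * r))) ≡ 9 * (2 * q * (2 * r) * (2 * q * (2 * r)))
  ring₃ = solve-∀

-- Equality of the two sets and its consequences.

𝒯⇒params : ∀ {a b} → (a , b) ∈ 𝒯 →
  ∃₂ λ q r → ∃₂ λ s t → a ≡ 2 * q × b ≡ 2 * r × Params q r s t
-- The integer root k may be negative; its absolute value has the same square.
𝒯⇒params {a} {b} (0<a , 0<b , _ , k , eq) = square⇒params a b ℤ.∣ k ∣ 0<a 0<b
  (trans (cong (ℤ.∣ k ∣ * ℤ.∣ k ∣ +_) (ring₁ (a + b)))
    (trans (difference⇒sum (ℤ.∣ k ∣ * ℤ.∣ k ∣) (trans (sym (ℤ-square k)) (sym eq))) (ring₂ a b)))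
  where
  ring₁ : ∀ n → 12 * (n * n) ≡ 12 * (n * (n * 1))
  ring₁ = solve-∀
  ring₂ : ∀ a b → 9 * (a * (a * 1)) * (b * (b * 1)) ≡ 9 * (a * b * (a * b))
  ring₂ = solve-∀

𝒯⊆𝒮 : ∀ {p} → p ∈ 𝒯 → p ∈ 𝒮
𝒯⊆𝒮 {a , b} p∈𝒯@(0<a , 0<b , a<b , _) = go 0<a 0<b a<b (𝒯⇒params p∈𝒯)
  where
  go : ∀ {a b} → 0 < a → 0 < b → a < b →
    (∃₂ λ q r → ∃₂ λ s t → a ≡ 2 * q × b ≡ 2 * r × Params q r s t) → (a , b) ∈ 𝒮
  go 0<a 0<b a<b (q , r , s , t , refl , refl , P) =
    q , r , *-cancelˡ-< 2 0 q 0<a , *-cancelˡ-< 2 0 r 0<b , refl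
    , (s , t) , params⇒corresponds (<⇒≤ (*-cancelˡ-< 2 q r a<b)) P
    , λ {(s′ , t′)} C → params-unique P (corresponds⇒params q r s′ t′ C)

𝒮⊆𝒯 : ∀ {p} → p ∈ 𝒮 → p ∈ 𝒯
𝒮⊆𝒯 (q , r , 0<q , 0<r , refl , (s , t) , C@(_ , _ , _ , _ , _ , _ , q≤r , _) , _) =
  ≤-trans 0<q (m≤n*m q 2) , ≤-trans 0<r (m≤n*m r 2)
  -- Parity rules out q = r, which turns q ≤ r into the strict a < b.
  , *-monoʳ-< 2 (≤∧≢⇒< q≤r (params⇒q≢r P))
  , ℤ.+ k , sym (trans (ℤ-square (ℤ.+ k)) (sum⇒difference (k * k)
      (trans (cong (k * k +_) (ring₁ (2 * q + 2 * r)))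
        (trans (params⇒square P) (ring₂ (2 * q) (2 * r))))))
  where
  P : Params q r s t
  P = corresponds⇒params q r s t C
  k : ℕ
  k = 6 * ∣ s * s - 3 * (t * t) ∣
  ring₁ : ∀ n → 12 * (n * (n * 1)) ≡ 12 * (n * n)
  ring₁ = solve-∀
  ring₂ : ∀ a b → 9 * (a * b * (a * b)) ≡ 9 * (a * (a * 1)) * (b * (b * 1))
  ring₂ = solve-∀

theorem2 : (𝒯 ≐ 𝒮)
    × (∀ (a b q r : ℕ) → (a , b) ∈ 𝒯 → (a , b) ≡ (2 * q , 2 * r) →
    (∀ (s t : ℕ) → Corresponds q r (s , t) →
    (a * b ≡ 2 * (s ^ 2 + 3 * t ^ 2)) × (a + b ≡ 6 * s * t))
    × Coprime q r
    × (3 ∤ a * b))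
theorem2 = (𝒯⊆𝒮 , 𝒮⊆𝒯) , λ where
    _ _ q r p∈𝒯 refl →
      (λ s t C → product-sum q r s t (corresponds⇒params q r s t C)) , coprime q r (𝒯⇒params p∈𝒯)
  where
  product-sum : ∀ q r s t → Params q r s t →
    2 * q * (2 * r) ≡ 2 * (s ^ 2 + 3 * t ^ 2) × 2 * q + 2 * r ≡ 6 * s * t
  product-sum q r s t (mkParams _ _ _ _ _ sum prod) =
      trans (ring₁ q r) (trans (cong (2 *_) prod) (ring₂ s t))
    , trans (sym (*-distribˡ-+ 2 q r)) (trans (cong (2 *_) sum) (ring₃ s t))
    where
    ring₁ : ∀ q r → 2 * q * (2 * r) ≡ 2 * (2 * (q * r))
    ring₁ = solve-∀
    ring₂ : ∀ s t → 2 * (s * s + 3 * (t * t)) ≡ 2 * (s * (s * 1) + 3 * (t * (t * 1)))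
    ring₂ = solve-∀
    ring₃ : ∀ s t → 2 * (3 * s * t) ≡ 6 * s * t
    ring₃ = solve-∀
  coprime : ∀ q r → (∃₂ λ q′ r′ → ∃₂ λ s t → 2 * q ≡ 2 * q′ × 2 * r ≡ 2 * r′ × Params q′ r′ s t) →
    Coprime q r × 3 ∤ 2 * q * (2 * r)
  coprime q r (q′ , r′ , s , t , 2q≡ , 2r≡ , P)
    -- Halving a and b determines q and r, so the parameters found for (a, b) belong to the given q
    -- and r.
    with refl ← *-cancelˡ-≡ q q′ 2 2q≡
    with refl ← *-cancelˡ-≡ r r′ 2 2r≡ = params⇒coprime P , params⇒3∤ab P
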